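{- Let $f\in F(n)$ have at least one fixed point. Then there exists $h\in F(n)$ with $h\sim f$ such that, from every configuration $x\in\{0,1\}^n$, $\mathcal{A}(h)$ has an almost decreasing path from $x$ to some fixed point of $h$.
   Context: $F(n)$ is the set of all functions $f:\{0,1\}^n\to\{0,1\}^n$, written $f=(f_1,\dots,f_n)$. $e_i$ is the configuration with a $1$ exactly in component $i$; addition is componentwise modulo $2$. The asynchronous graph $\mathcal{A}(f)$ is the digraph on $\{0,1\}^n$ with an arc from $x$ to $x+e_i$ whenever $f_i(x)\neq x_i$. $\leq$ denotes the componentwise partial order on $\{0,1\}^n$. An arc from $x$ to $y$ in $\mathcal{A}(h)$ is increasing if $x<y$ and decreasing otherwise. A path is almost decreasing if all its arcs, except possibly one, are decreasing (paths of length $0$ are allowed). $\mathcal{S}(f)$ has an arc $x\to f(x)$; $f\sim h$ means $\mathcal{S}(f)$ and $\mathcal{S}(h)$ are isomorphic. -}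

module Defs where

open import Data.Nat using (ℕ; zero; suc; _≤_)
open import Data.Bool using (Bool; true; false; not)
open import Data.Fin using (Fin)
open import Data.Vec using (Vec; lookup; updateAt)
open import Data.Product using (Σ; ∃; _×_; _,_)
open import Relation.Nullary using (¬_)
open import Relation.Binary.PropositionalEquality using (_≡_; _≢_)

Config : ℕ → Set
Config n = Vec Bool n

F : ℕ → Set
F n = Config n → Config n

flip : ∀ {n} → Config n → Fin n → Config n
flip x i = updateAt x i not

data _≤ᵇ_ : Bool → Bool → Set where
  f≤b : ∀ {b} → false ≤ᵇ b
  t≤t : true ≤ᵇ true

_≤ᶜ_ : ∀ {n} → Config n → Config n → Set
x ≤ᶜ y = ∀ i → lookup x i ≤ᵇ lookup y i

_<ᶜ_ : ∀ {n} → Config n → Config n → Set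
x <ᶜ y = (x ≤ᶜ y) × (x ≢ y)

IsFixed : ∀ {n} → F n → Config n → Set
IsFixed f x = f x ≡ x

AsyncArc : ∀ {n} → F n → Config n → Config n → Set
AsyncArc {n} f x y = Σ (Fin n) λ i → (lookup (f x) i ≢ lookup x i) × (y ≡ flip x i)

Decreasing : ∀ {n} → Config n → Config n → Set
Decreasing x y = ¬ (x <ᶜ y)

data Path {n} (f : F n) : Config n → Config n → ℕ → Set where
  []     : ∀ {x} → Path f x x 0
  decArc : ∀ {x y z k} → AsyncArc f x y → Decreasing x y → Path f y z k → Path f x z k
  incArc : ∀ {x y z k} → AsyncArc f x y → x <ᶜ y → Path f y z k → Path f x z (suc k)

AlmostDecreasingPath : ∀ {n} → F n → Config n → Config n → Set
AlmostDecreasingPath f x y = Σ ℕ λ k → (k ≤ 1) × Path f x y k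

-- f ∼ h : the synchronous graphs S(f) (arcs x → f x) and S(h) are isomorphic,
-- i.e. there is a bijection φ on {0,1}^n with φ (f x) ≡ h (φ x)
_∼_ : ∀ {n} → F n → F n → Set
_∼_ {n} f h = Σ (Config n → Config n) λ φ → Σ (Config n → Config n) λ ψ →
  (∀ x → ψ (φ x) ≡ x) × (∀ y → φ (ψ y) ≡ y) × (∀ x → φ (f x) ≡ h (φ x))

{-# OPTIONS --safe #-}

-- Suppose the configurations are enumerated as w₀, w₁, …, w_{N-1} (N = 2ⁿ) with w₀ fixed by f and
-- f(w_k) ∈ {w₀, …, w_{k+1}} for all k: repeatedly append f of the last element if it is new, and
-- any new element otherwise.  Transport f along w_k ↦ v_k, where v₀ = 0, …, v_{N-1} = 1 is a linear
-- extension of ≤ in which consecutive elements, the two end pairs excepted, are incomparable.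
-- Then h(v_k) ≥ v_k is impossible for non-fixed v_k, so that v_k has a decreasing arc, except when
-- k = N-2 and h(v_{N-2}) = v_{N-1}.  In that case v_{N-2} is one increasing arc below
-- v_{N-1} = 1, and 1 has a decreasing arc that avoids v_{N-2} unless h(1) = v_{N-2}.  The latter is
-- excluded by enumerating the 2-cycles of f right after w₀: as N is even, they do not exhaust
-- the configurations, so w_{N-1} does not lie on a 2-cycle.
module Submission where

open import Defs
open import Data.Bool using (true; false; not)
import Data.Bool.Properties as Bool
open import Data.Fin using (Fin; zero; suc; toℕ; _>_) renaming (_<_ to _<ᶠ_)
import Data.Fin.Properties as Fin
open import Data.Fin.Induction using (>-wellFounded)
open import Data.List using (List; []; _∷_; _++_; [_]; length; map; lookup)
open import Data.List.Properties using (length-++; length-map)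
open import Data.List.Membership.Propositional using (_∈_; find)
open import Data.List.Membership.Propositional.Properties using (∈-∃++; ∈-++⁺ˡ; ∈-++⁺ʳ; ∈-++⁻; ∈-map⁺; ∈-lookup)
open import Data.List.Relation.Unary.All as All using (All; []; _∷_)
import Data.List.Relation.Unary.All.Properties as All
open import Data.List.Relation.Unary.AllPairs as AllPairs using (AllPairs; []; _∷_)
import Data.List.Relation.Unary.AllPairs.Properties as AllPairs
open import Data.List.Relation.Unary.Any as Any using (here; there; any?)
open import Data.List.Relation.Unary.Any.Properties using (lookup-index)
open import Data.List.Relation.Unary.Linked as Linked using (Linked; []; [-]; _∷_)
import Data.List.Relation.Unary.Linked.Properties as Linked
open import Data.List.Relation.Unary.Unique.Propositional using (Unique)
open import Data.List.Relation.Unary.Unique.Propositional.Properties using (Unique[x∷xs]⇒x∉xs)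
open import Data.List.Relation.Binary.Permutation.Propositional using (_↭_; ↭-sym; ↭-trans; ↭-refl; ↭⇒↭ₛ)
open import Data.List.Relation.Binary.Permutation.Propositional.Properties using (∈-resp-↭; All-resp-↭; ↭-length; shift; ++⁺ˡ; ++-identityʳ)
import Data.List.Relation.Binary.Permutation.Setoid.Properties as Permutationₛ
open import Data.Nat using (ℕ; zero; suc; _≤_; z≤n; s≤s; parity)
open import Data.Nat.Properties using (≤-refl; ≤-trans; ≤-antisym; ≤∧≢⇒<; <⇒≤; n≤1+n; suc-injective)
open import Data.Parity.Base as ℙ using (0ℙ; 1ℙ)
open import Data.Parity.Properties using (+-homo-+)
open import Data.Product using (Σ; ∃; ∃₂; _×_; _,_; proj₁)
open import Data.Sum using (_⊎_; inj₁; inj₂)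
open import Data.Vec as Vec using ([]; _∷_; replicate)
open import Data.Vec.Properties using (≡-dec; lookup∘updateAt; lookup-replicate)
open import Function using (_∘_; _↔_; Inverse; mk↔ₛ′)
open import Induction.WellFounded using (Acc; acc)
open import Relation.Binary using (DecidableEquality; tri<; tri≈; tri>)
open import Relation.Binary.PropositionalEquality using (_≡_; _≢_; refl; sym; trans; cong; cong₂; subst; subst₂; setoid)
open import Relation.Nullary using (¬_; yes; no; ¬?; contradiction; _×-dec_)

private
  variable
    A : Set
    n : ℕ

-- Lists

allPairs-lookup : {R : A → A → Set} {xs : List A} → AllPairs R xs →
                  ∀ i j → i <ᶠ j → R (lookup xs i) (lookup xs j)
allPairs-lookup {xs = _ ∷ xs} (r ∷ _) zero (suc j) _ = All.lookup r (∈-lookup j)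
allPairs-lookup (_ ∷ rs) (suc i) (suc j) (s≤s i<j) = allPairs-lookup rs i j i<j

-- The appended `b` will be `zeros`, which is comparable with its neighbour; the inequality on
-- lengths excludes exactly the pair ending there.
linked-lookup-∷ʳ : {R : A → A → Set} {xs : List A} {b : A} → Linked R xs →
                   ∀ j i → toℕ i ≡ suc (toℕ j) → suc (toℕ i) ≢ length (xs ++ [ b ]) →
                   R (lookup (xs ++ [ b ]) j) (lookup (xs ++ [ b ]) i)
linked-lookup-∷ʳ []       zero    (suc ())       _  _
linked-lookup-∷ʳ [-]      zero    (suc zero)     _  ne = contradiction refl ne
linked-lookup-∷ʳ [-]      (suc zero) (suc zero)  () _
linked-lookup-∷ʳ (r ∷ _)  zero    (suc zero)     _  _  = r
linked-lookup-∷ʳ (_ ∷ rs) (suc j) (suc i)        eq ne =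
  linked-lookup-∷ʳ rs j i (suc-injective eq) (ne ∘ cong suc)

linked-∷ : {R : A → A → Set} {b : A} {ys : List A} → All (R b) ys → Linked R ys → Linked R (b ∷ ys)
linked-∷ []      []  = [-]
linked-∷ (r ∷ _) rs  = r ∷ rs

-- Only the last element of `xs` meets `b`, but asking for the relation on all of `xs` avoids
-- singling it out, and the application can supply it.
linked-++-∷ : {R : A → A → Set} {xs ys : List A} {b : A} → Linked R xs → All (λ a → R a b) xs →
              Linked R (b ∷ ys) → Linked R (xs ++ b ∷ ys)
linked-++-∷ []       _        rys = rys
linked-++-∷ [-]      (r ∷ _)  rys = r ∷ rys
linked-++-∷ (r ∷ rs) (_ ∷ qs) rys = r ∷ linked-++-∷ rs qs rys

unique⇒lookup-injective : {xs : List A} → Unique xs → ∀ i j → lookup xs i ≡ lookup xs j → i ≡ j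
unique⇒lookup-injective u i j eq with Fin.<-cmp i j
... | tri< i<j _ _ = contradiction eq (allPairs-lookup u i j i<j)
... | tri≈ _ i≡j _ = i≡j
... | tri> _ _ j<i = contradiction (sym eq) (allPairs-lookup u j i j<i)

list-enumeration : {xs : List A} → Unique xs → (∀ x → x ∈ xs) → Fin (length xs) ↔ A
list-enumeration {xs = xs} u complete = mk↔ₛ′ (lookup xs) (Any.index ∘ complete) at-index
  (λ i → unique⇒lookup-injective u _ _ (at-index (lookup xs i)))
  where
  at-index : ∀ x → lookup xs (Any.index (complete x)) ≡ x
  at-index x = sym (lookup-index (complete x))

unique-resp-↭ : {xs ys : List A} → xs ↭ ys → Unique xs → Unique ys
unique-resp-↭ {A} p = Permutationₛ.Unique-resp-↭ (setoid A) (↭⇒↭ₛ p)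

extract : {x : A} {xs : List A} → x ∈ xs → ∃ λ ys → xs ↭ x ∷ ys
extract x∈xs with ys , zs , refl ← ∈-∃++ x∈xs = ys ++ zs , shift _ ys zs

transfer : {x : A} (ws : List A) {xs ys zs : List A} → xs ↭ x ∷ ys → ws ++ xs ↭ zs → (x ∷ ws) ++ ys ↭ zs
transfer {x = x} ws {ys = ys} p q = ↭-trans (↭-sym (shift x ws ys)) (↭-trans (++⁺ˡ ws (↭-sym p)) q)

-- Arrangements of a self-map

-- Positions are counted from the end: in the notation above, `to` sends k to w_{N-1-k}.
record Arrangement (f : A → A) (N : ℕ) : Set where
  field
    enumeration : Fin N ↔ A

  open Inverse enumeration public using (to; from) renaming (strictlyInverseˡ to to-from; strictlyInverseʳ to from-to)

  step : Fin N → Fin N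
  step i = from (f (to i))

  field
    step-bound   : ∀ i → toℕ i ≤ suc (toℕ (step i))
    bottom-fixed : ∀ i → suc (toℕ i) ≡ N → step i ≡ i
    top-acyclic  : ∀ i → toℕ i ≡ 0 → step (step i) ≡ i → step i ≡ i

module Arrange (_≟ᴬ_ : DecidableEquality A) (f : A → A) where

  open import Data.List.Membership.DecPropositional _≟ᴬ_ using (_∈?_)

  -- The newest element is the head. The image of an element is constrained only when another one is
  -- put in front of it, so the image of the final head w_{N-1} stays free.
  data Trail : List A → Set where
    root   : ∀ {x} → f x ≡ x → Trail [ x ]
    extend : ∀ {x y ws} → Trail (y ∷ ws) → f y ∈ x ∷ y ∷ ws → Trail (x ∷ y ∷ ws)

  Closed : List A → Set
  Closed ws = ∀ {y} → y ∈ ws → f y ∈ ws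

  OnTwoCycle : A → Set
  OnTwoCycle x = f (f x) ≡ x × f x ≢ x

  closed-extend : ∀ {ws} → Trail ws → Closed ws → ∀ x → Trail (x ∷ ws)
  closed-extend t@(root _)     c x = extend t (there (c (here refl)))
  closed-extend t@(extend _ _) c x = extend t (there (c (here refl)))

  -- Index `i` of `ws` is index `suc i` of `x ∷ ws`, so the bound lets `f` move at most one place
  -- towards the head.
  trail-lookup : ∀ {x ws} → Trail (x ∷ ws) → ∀ i →
                 ∃ λ j → lookup (x ∷ ws) j ≡ f (lookup ws i) × toℕ i ≤ toℕ j
  trail-lookup (extend t fy∈) zero    = Any.index fy∈ , sym (lookup-index fy∈) , z≤n
  trail-lookup (extend t fy∈) (suc i) with j , eq , i≤j ← trail-lookup t i = suc j , eq , s≤s i≤j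

  trail-root : ∀ {ws} → Trail ws → ∀ i → suc (toℕ i) ≡ length ws → f (lookup ws i) ≡ lookup ws i
  trail-root (root fx)    zero    _  = fx
  trail-root (extend t _) (suc i) eq = trail-root t i (suc-injective eq)

  module _ {xs : List A} (unique : Unique xs) (complete : ∀ x → x ∈ xs) where

    -- Whole 2-cycles move from `rs` to `ws`, which keeps `ws` closed and the parity of `rs` odd.
    -- The number `m` is fuel.
    exhaust-two-cycles : ∀ m ws rs → length rs ≤ m → Trail ws → Closed ws →
      parity (length rs) ≡ 1ℙ → ws ++ rs ↭ xs →
      ∃₂ λ ws rs → Trail ws × Closed ws × parity (length rs) ≡ 1ℙ × ws ++ rs ↭ xs ×
        All (¬_ ∘ OnTwoCycle) rs
    exhaust-two-cycles m ws rs ≤m t c odd p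
      with any? (λ x → (f (f x) ≟ᴬ x) ×-dec ¬? (f x ≟ᴬ x)) rs
    ... | no none = ws , rs , t , c , odd , p , All.¬Any⇒All¬ rs none
    ... | yes some
      with x , x∈rs , ffx≡x , fx≢x ← find some
      with rs′ , q ← extract x∈rs
      = pair (∈-++⁻ (x ∷ ws) (∈-resp-↭ (↭-sym p′) (complete (f x))))
      where
      p′ : (x ∷ ws) ++ rs′ ↭ xs
      p′ = transfer ws q p

      pair : f x ∈ x ∷ ws ⊎ f x ∈ rs′ → _
      pair (inj₁ (here fx≡x))   = contradiction fx≡x fx≢x
      -- Closedness would bring `f (f x)`, that is `x`, into `ws`, and `x` would be enumerated
      -- twice.
      pair (inj₁ (there fx∈ws)) = contradiction (∈-++⁺ˡ (subst (_∈ ws) ffx≡x (c fx∈ws)))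
        (Unique[x∷xs]⇒x∉xs (unique-resp-↭ (↭-sym p′) unique))
      pair (inj₂ fx∈rs′)
        with rs″ , q′ ← extract fx∈rs′
        = next m (subst (_≤ m) len ≤m)
        where
        len : length rs ≡ suc (suc (length rs″))
        len = trans (↭-length q) (cong suc (↭-length q′))

        closed : Closed (f x ∷ x ∷ ws)
        closed (here refl)         = there (here ffx≡x)
        closed (there (here refl)) = here refl
        closed (there (there y∈))  = there (there (c y∈))

        next : ∀ m → suc (suc (length rs″)) ≤ m → _
        next (suc m) (s≤s ≤m) = exhaust-two-cycles m (f x ∷ x ∷ ws) rs″ (≤-trans (n≤1+n _) ≤m)
          (extend (closed-extend t c x) (here refl)) closed (trans (cong parity (sym len)) odd)
          (transfer (x ∷ ws) q′ p′)

    -- Each new head is `f y` if that is still available, and otherwise arbitrary. All heads come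
    -- from `rs`, apart from the initial one, so the last head inherits the absence of 2-cycles.
    exhaust : ∀ m y ws rs → length rs ≡ m → Trail (y ∷ ws) → (y ∷ ws) ++ rs ↭ xs →
      ¬ OnTwoCycle y → All (¬_ ∘ OnTwoCycle) rs →
      ∃₂ λ y ws → Trail (y ∷ ws) × y ∷ ws ↭ xs × ¬ OnTwoCycle y
    exhaust zero    y ws []          _   t p ¬two _ =
      y , ws , t , ↭-trans (↭-sym (++-identityʳ (y ∷ ws))) p , ¬two
    exhaust (suc m) y ws rs@(a ∷ as) len t p ¬two ¬twos with f y ∈? rs
    ... | yes fy∈rs
      with rs′ , q ← extract fy∈rs
      with ¬two′ ∷ ¬twos′ ← All-resp-↭ q ¬twos
      = exhaust m (f y) (y ∷ ws) rs′ (suc-injective (trans (sym (↭-length q)) len))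
          (extend t (here refl)) (transfer (y ∷ ws) q p) ¬two′ ¬twos′
    ... | no fy∉rs = exhaust m a (y ∷ ws) as (suc-injective len)
          (extend t (there fy∈)) (transfer (y ∷ ws) ↭-refl p) (All.head ¬twos) (All.tail ¬twos)
      where
      fy∈ : f y ∈ y ∷ ws
      fy∈ with ∈-++⁻ (y ∷ ws) (∈-resp-↭ (↭-sym p) (complete (f y)))
      ... | inj₁ fy∈ws = fy∈ws
      ... | inj₂ fy∈rs = contradiction fy∈rs fy∉rs

    trail : parity (length xs) ≡ 0ℙ → (∃ λ x → f x ≡ x) →
            ∃₂ λ y ws → Trail (y ∷ ws) × y ∷ ws ↭ xs × ¬ OnTwoCycle y
    trail even (x , fx≡x)
      with rs , q ← extract (complete x)
      with exhaust-two-cycles (length rs) [ x ] rs ≤-refl (root fx≡x) closed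
             (odd (length rs) (trans (cong parity (sym (↭-length q))) even)) (↭-sym q)
      where
      closed : Closed [ x ]
      closed (here refl) = here fx≡x

      odd : ∀ m → parity (suc m) ≡ 0ℙ → parity m ≡ 1ℙ
      odd (suc zero)    _ = refl
      odd (suc (suc m)) e = odd m e
    -- Odd parity rules out an empty remainder, so some `y` off all 2-cycles is left; as `ws` is
    -- closed, any element may follow it.
    ... | ws , y ∷ rs , t , c , _ , p , ¬two ∷ ¬twos =
      exhaust (length rs) y ws rs refl (closed-extend t c y) (transfer ws ↭-refl p) ¬two ¬twos

    arrangement : parity (length xs) ≡ 0ℙ → (∃ λ x → f x ≡ x) → Arrangement f (length xs)
    arrangement even fixed with y , ws , t , p , ¬two ← trail even fixed =
      subst (Arrangement f) (↭-length p) record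
        { enumeration  = enum
        ; step-bound   = bound
        ; bottom-fixed = λ i eq → trans (cong from (trail-root t i eq)) (from-to i)
        ; top-acyclic  = top
        }
      where
      enum : Fin (length (y ∷ ws)) ↔ A
      enum = list-enumeration (unique-resp-↭ (↭-sym p) unique) (∈-resp-↭ (↭-sym p) ∘ complete)

      open Inverse enum using (to; from) renaming (strictlyInverseˡ to to-from; strictlyInverseʳ to from-to)

      bound : ∀ i → toℕ i ≤ suc (toℕ (from (f (to i))))
      bound zero = z≤n
      bound (suc i) with j , eq , i≤j ← trail-lookup t i =
        s≤s (subst (λ k → toℕ i ≤ toℕ k) (trans (sym (from-to j)) (cong from eq)) i≤j)

      top : ∀ i → toℕ i ≡ 0 → from (f (to (from (f (to i))))) ≡ i → from (f (to i)) ≡ i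
      top zero _ eq with f y ≟ᴬ y
      ... | yes fy≡y = trans (cong from fy≡y) (from-to zero)
      ... | no  fy≢y = contradiction (ffy≡y , fy≢y) ¬two
        where
        ffy≡y : f (f y) ≡ y
        ffy≡y = trans (cong f (sym (to-from (f y)))) (trans (sym (to-from _)) (cong to eq))

-- A linear extension of the cube

t≰f : ¬ (true ≤ᵇ false)
t≰f ()

ones zeros : Config n
ones  = replicate _ true
zeros = replicate _ false

≰-head : {x y : Config n} → ¬ ((true ∷ x) ≤ᶜ (false ∷ y))
≰-head p = t≰f (p zero)

≰-tail : ∀ {a b} {x y : Config n} → ¬ (x ≤ᶜ y) → ¬ ((a ∷ x) ≤ᶜ (b ∷ y))
≰-tail x≰y p = x≰y (p ∘ suc)

≤ᵇ-refl : ∀ b → b ≤ᵇ b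
≤ᵇ-refl false = f≤b
≤ᵇ-refl true  = t≤t

≤ᶜ-reflexive : {x y : Config n} → x ≡ y → x ≤ᶜ y
≤ᶜ-reflexive refl i = ≤ᵇ-refl _

-- The decreasing lexicographic order with true ∷ zeros and false ∷ ones swapped at every level:
-- without the swap, they would be comparable to their outer neighbours.
middle : ∀ n → List (Config (suc n))
middle zero    = []
middle (suc n) = map (true ∷_) (middle n) ++ (false ∷ ones) ∷ (true ∷ zeros) ∷ map (false ∷_) (middle n)

descending : ∀ n → List (Config (suc n))
descending n = ones ∷ middle n ++ [ zeros ]

-- This amounts to being neither `ones` nor `zeros`; the form with `≤ᶜ` is what `≰-tail` takes.
Proper : Config n → Set
Proper x = ¬ (ones ≤ᶜ x) × ¬ (x ≤ᶜ zeros)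

middle-proper : ∀ n → All Proper (middle n)
middle-proper zero    = []
middle-proper (suc n) = All.++⁺
  (All.map⁺ (All.map (λ (p , _) → ≰-tail p , ≰-head) (middle-proper n)))
  ((≰-head , ≰-tail ≰-head) ∷ (≰-tail ≰-head , ≰-head) ∷
   All.map⁺ (All.map (λ (_ , q) → ≰-head , ≰-tail q) (middle-proper n)))

-- The swap is harmless: `false ∷ ones` and `true ∷ zeros` are incomparable, their tails being
-- nonempty. All other pairs are settled by the first component or by the tails.
middle-antitone : ∀ n → AllPairs (λ x y → ¬ (x ≤ᶜ y)) (middle n)
middle-antitone zero    = []
middle-antitone (suc n) = AllPairs.++⁺
  (AllPairs.map⁺ (AllPairs.map ≰-tail (middle-antitone n)))
  ((≰-tail ≰-head ∷ All.map⁺ (All.map (λ (p , _) → ≰-tail p) (middle-proper n))) ∷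
   All.map⁺ (All.universal (λ _ → ≰-head) _) ∷
   AllPairs.map⁺ (AllPairs.map ≰-tail (middle-antitone n)))
  (All.map⁺ (All.map (λ (_ , q) →
    ≰-head ∷ ≰-tail q ∷ All.map⁺ (All.universal (λ _ → ≰-head) _)) (middle-proper n)))

descending-antitone : ∀ n → AllPairs (λ x y → ¬ (x ≤ᶜ y)) (descending n)
descending-antitone n =
  All.++⁺ (All.map proj₁ (middle-proper n)) (≰-head ∷ []) ∷
  AllPairs.++⁺ (middle-antitone n) ([] ∷ []) (All.map (λ (_ , q) → q ∷ []) (middle-proper n))

-- Together with `middle-antitone` this makes neighbours incomparable. At the two outer joints the
-- tails decide, since a proper tail is neither above `ones` nor below `zeros`; between the swapped
-- elements the heads decide.
middle-linked : ∀ n → Linked (λ x y → ¬ (y ≤ᶜ x)) (middle n)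
middle-linked zero    = []
middle-linked (suc n) = linked-++-∷
  (Linked.map⁺ (Linked.map ≰-tail (middle-linked n)))
  (All.map⁺ (All.map (λ (p , _) → ≰-tail p) (middle-proper n)))
  (≰-head ∷ linked-∷ (All.map⁺ (All.map (λ (_ , q) → ≰-tail q) (middle-proper n)))
    (Linked.map⁺ (Linked.map ≰-tail (middle-linked n))))

middle-complete : ∀ n (x : Config (suc n)) → x ≡ ones ⊎ x ≡ zeros ⊎ x ∈ middle n
middle-complete zero (true  ∷ []) = inj₁ refl
middle-complete zero (false ∷ []) = inj₂ (inj₁ refl)
middle-complete (suc n) (true ∷ x) with middle-complete n x
... | inj₁ refl        = inj₁ refl
... | inj₂ (inj₁ refl) = inj₂ (inj₂ (∈-++⁺ʳ (map (true ∷_) (middle n)) (there (here refl))))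
... | inj₂ (inj₂ x∈)   = inj₂ (inj₂ (∈-++⁺ˡ (∈-map⁺ (true ∷_) x∈)))
middle-complete (suc n) (false ∷ x) with middle-complete n x
... | inj₁ refl        = inj₂ (inj₂ (∈-++⁺ʳ (map (true ∷_) (middle n)) (here refl)))
... | inj₂ (inj₁ refl) = inj₂ (inj₁ refl)
... | inj₂ (inj₂ x∈)   = inj₂ (inj₂ (∈-++⁺ʳ (map (true ∷_) (middle n)) (there (there (∈-map⁺ (false ∷_) x∈)))))

descending-complete : ∀ n (x : Config (suc n)) → x ∈ descending n
descending-complete n x with middle-complete n x
... | inj₁ refl        = here refl
... | inj₂ (inj₁ refl) = there (∈-++⁺ʳ (middle n) (here refl))
... | inj₂ (inj₂ x∈)   = there (∈-++⁺ˡ x∈)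

descending-unique : ∀ n → Unique (descending n)
descending-unique n = AllPairs.map (_∘ ≤ᶜ-reflexive) (descending-antitone n)

parity-++ : (xs ys : List A) →
            parity (length (xs ++ ys)) ≡ parity (length xs) ℙ.+ parity (length ys)
parity-++ xs ys = trans (cong parity (length-++ xs)) (+-homo-+ (length xs) (length ys))

middle-even : ∀ n → parity (length (middle n)) ≡ 0ℙ
middle-even zero    = refl
middle-even (suc n) = trans (parity-++ (map (true ∷_) (middle n)) _)
  -- The two swapped elements disappear by computation, as `parity` recurses in steps of two.
  (cong₂ ℙ._+_ (map-even true) (map-even false))
  where
  map-even : ∀ b → parity (length (map (b ∷_) (middle n))) ≡ 0ℙ
  map-even b = trans (cong parity (length-map (b ∷_) (middle n))) (middle-even n)

descending-even : ∀ n → parity (length (descending n)) ≡ 0ℙ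
descending-even n = trans (parity-++ [ ones ] (middle n ++ [ zeros ]))
  (cong (1ℙ ℙ.+_) (trans (parity-++ (middle n) [ zeros ]) (cong (ℙ._+ 1ℙ) (middle-even n))))

-- The list has to continue with a coatom so that the exceptional configuration is a single arc away
-- from `ones`.
descending-coatom : ∀ n → ∃₂ λ c xs → descending n ≡ ones ∷ flip ones c ∷ xs
descending-coatom zero    = zero , [] , refl
descending-coatom (suc n) with middle n | descending-coatom n
... | []    | _             = zero , _ , refl
... | _ ∷ _ | c , _ , refl  = suc c , _ , refl

second-lookup : {xs ys : List A} {a b : A} → xs ≡ a ∷ b ∷ ys →
                ∃ λ (i : Fin (length xs)) → toℕ i ≡ 1 × lookup xs i ≡ b
second-lookup refl = suc zero , refl , refl

-- Decreasing arcs

_≟ᶜ_ : DecidableEquality (Config n)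
_≟ᶜ_ = ≡-dec Bool._≟_

≰⇒descent : (x y : Config n) → ¬ (x ≤ᶜ y) → ∃ λ i → Vec.lookup x i ≡ true × Vec.lookup y i ≡ false
≰⇒descent []          []          x≰y = contradiction (λ ()) x≰y
≰⇒descent (true  ∷ x) (false ∷ y) x≰y = zero , refl , refl
≰⇒descent (false ∷ x) (b ∷ y)     x≰y
  with i , p ← ≰⇒descent x y (λ x≤y → x≰y λ { zero → f≤b ; (suc i) → x≤y i }) = suc i , p
≰⇒descent (true  ∷ x) (true ∷ y)  x≰y
  with i , p ← ≰⇒descent x y (λ x≤y → x≰y λ { zero → t≤t ; (suc i) → x≤y i }) = suc i , p

flip-≢ : (x : Config n) (i : Fin n) → flip x i ≢ x
flip-≢ (true  ∷ x) zero    ()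
flip-≢ (false ∷ x) zero    ()
flip-≢ (_ ∷ x)     (suc i) eq = flip-≢ x i (cong Vec.tail eq)

flip-≤ : (x : Config n) (i : Fin n) → Vec.lookup x i ≡ true → flip x i ≤ᶜ x
flip-≤ (true ∷ x) zero    _  zero    = f≤b
flip-≤ (true ∷ x) zero    _  (suc j) = ≤ᵇ-refl _
flip-≤ (b ∷ x)    (suc i) _  zero    = ≤ᵇ-refl _
flip-≤ (b ∷ x)    (suc i) xi (suc j) = flip-≤ x i xi j

descent-arc : (h : F n) {x : Config n} {i : Fin n} {z : Config n} {k : ℕ} →
              Vec.lookup x i ≡ true → Vec.lookup (h x) i ≡ false → Path h (flip x i) z k → Path h x z k
descent-arc h {x} {i} xi hxi = decArc
  (i , (λ eq → contradiction (trans (sym hxi) (trans eq xi)) λ ()) , refl)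
  (λ (x≤ , _) → t≰f (subst₂ _≤ᵇ_ xi (trans (lookup∘updateAt i x) (cong not xi)) (x≤ i)))

ones-dichotomy : (x : Config n) → x ≡ ones ⊎ ∃ λ i → Vec.lookup x i ≡ false
ones-dichotomy []          = inj₁ refl
ones-dichotomy (false ∷ x) = inj₂ (zero , refl)
ones-dichotomy (true  ∷ x) with ones-dichotomy x
... | inj₁ refl     = inj₁ refl
... | inj₂ (i , xi) = inj₂ (suc i , xi)

-- Applied to `h ones`: the last alternative is a decreasing arc from `ones` that misses the coatom.
coatom-trichotomy : (x : Config n) (c : Fin n) →
  x ≡ ones ⊎ x ≡ flip ones c ⊎ ∃ λ i → i ≢ c × Vec.lookup x i ≡ false
coatom-trichotomy (b ∷ x) zero with b | ones-dichotomy x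
... | true  | inj₁ refl     = inj₁ refl
... | false | inj₁ refl     = inj₂ (inj₁ refl)
... | _     | inj₂ (i , xi) = inj₂ (inj₂ (suc i , (λ ()) , xi))
coatom-trichotomy (false ∷ x) (suc c) = inj₂ (inj₂ (zero , (λ ()) , refl))
coatom-trichotomy (true  ∷ x) (suc c) with coatom-trichotomy x c
... | inj₁ refl                   = inj₁ refl
... | inj₂ (inj₁ refl)            = inj₂ (inj₁ refl)
... | inj₂ (inj₂ (i , i≢c , xi)) = inj₂ (inj₂ (suc i , i≢c ∘ Fin.suc-injective , xi))

flip-injective : (x : Config n) (i j : Fin n) → flip x i ≡ flip x j → i ≡ j
flip-injective (_ ∷ x) zero    zero    _  = refl
flip-injective (_ ∷ x) (suc i) (suc j) eq = cong suc (flip-injective x i j (cong Vec.tail eq))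
flip-injective (true  ∷ x) zero    (suc j) ()
flip-injective (false ∷ x) zero    (suc j) ()
flip-injective (true  ∷ x) (suc i) zero    ()
flip-injective (false ∷ x) (suc i) zero    ()

flip-involutive : (x : Config n) (i : Fin n) → flip (flip x i) i ≡ x
flip-involutive (true  ∷ x) zero    = refl
flip-involutive (false ∷ x) zero    = refl
flip-involutive (b ∷ x)     (suc i) = cong (b ∷_) (flip-involutive x i)

module Descent {N : ℕ} (v : Fin N ↔ Config n)
  (antitone : ∀ i j → i <ᶠ j → ¬ (Inverse.to v i ≤ᶜ Inverse.to v j)) (h : F n) where

  open Inverse v using (to; from) renaming (strictlyInverseˡ to to-from; strictlyInverseʳ to from-to)

  ReachesFixed : ℕ → Config n → Set
  ReachesFixed k x = ∃ λ y → IsFixed h y × Path h x y k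

  -- Turning a 1 into a 0 goes down in the order, hence to a later position by `antitone`. This
  -- makes `descend` terminate.
  from-flip : ∀ i c → Vec.lookup (to i) c ≡ true → i <ᶠ from (flip (to i) c)
  from-flip i c ic with Fin.<-cmp i (from (flip (to i) c))
  ... | tri< i<j _ _ = i<j
  ... | tri≈ _ i≡j _ = contradiction (sym (trans (cong to i≡j) (to-from _))) (flip-≢ (to i) c)
  ... | tri> _ _ j<i = contradiction (subst (_≤ᶜ to i) (sym (to-from _)) (flip-≤ (to i) c ic)) (antitone _ _ j<i)

  -- Positions only grow along decreasing arcs, so a path that starts at or after the threshold `m`
  -- never needs the hypothesis before it.
  descend : ∀ m → (∀ i → m ≤ toℕ i → ¬ IsFixed h (to i) → ¬ (to i ≤ᶜ h (to i))) →
            ∀ i → m ≤ toℕ i → ReachesFixed 0 (to i)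
  descend m descends i = go i (>-wellFounded i)
    where
    go : ∀ i → Acc _>_ i → m ≤ toℕ i → ReachesFixed 0 (to i)
    go i (acc rec) m≤i with h (to i) ≟ᶜ to i
    ... | yes fixed = to i , fixed , []
    ... | no ¬fixed
      with c , ic , hc ← ≰⇒descent (to i) (h (to i)) (descends i m≤i ¬fixed)
      with i<j ← from-flip i c ic
      with y , fixed , path ← go (from (flip (to i) c)) (rec i<j) (≤-trans m≤i (<⇒≤ i<j))
      = y , fixed , descent-arc h ic hc (subst (λ x → Path h x y 0) (to-from _) path)

-- The conjugate map and its almost decreasing paths

module Conjugate (n : ℕ) {f : F (suc n)} (arr : Arrangement f (length (descending n))) where

  v : Fin (length (descending n)) ↔ Config (suc n)
  v = list-enumeration (descending-unique n) (descending-complete n)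

  module V = Inverse v

  open Arrangement arr

  h : F (suc n)
  h x = V.to (step (V.from x))

  h∼f : h ∼ f
  h∼f = (λ x → to (V.from x)) , (λ y → V.to (from y)) ,
    (λ x → trans (cong V.to (from-to _)) (V.strictlyInverseˡ x)) ,
    (λ y → trans (cong to (V.strictlyInverseʳ _)) (to-from y)) ,
    (λ x → trans (cong to (V.strictlyInverseʳ _)) (to-from _))

  h-at : ∀ i → h (V.to i) ≡ V.to (step i)
  h-at i = cong (V.to ∘ step) (V.strictlyInverseʳ i)

  antitone : ∀ i j → i <ᶠ j → ¬ (V.to i ≤ᶜ V.to j)
  antitone = allPairs-lookup (descending-antitone n)

  open Descent v antitone h

  -- A move to a later position is covered by `antitone`. A move to an earlier one goes back exactly
  -- one place by `step-bound`, to an incomparable neighbour: `not-top` excludes the top pair and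
  -- `bottom-fixed` the bottom pair.
  step-not-above : ∀ i → step i ≢ i → ¬ (toℕ i ≡ 1 × step i ≡ zero) → ¬ (V.to i ≤ᶜ V.to (step i))
  step-not-above i moves not-top with Fin.<-cmp i (step i)
  ... | tri< i<s _ _ = antitone i (step i) i<s
  ... | tri≈ _ i≡s _ = contradiction (sym i≡s) moves
  ... | tri> _ _ s<i = previous i (step i) (≤-antisym (step-bound i) s<i) not-top (moves ∘ bottom-fixed i)
    where
    previous : ∀ i j → toℕ i ≡ suc (toℕ j) → ¬ (toℕ i ≡ 1 × j ≡ zero) →
               suc (toℕ i) ≢ length (descending n) → ¬ (V.to i ≤ᶜ V.to j)
    previous i       zero    eq not-top _          = contradiction (eq , refl) not-top
    previous (suc i) (suc j) eq _       not-bottom =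
      linked-lookup-∷ʳ (middle-linked n) j i (suc-injective eq) (not-bottom ∘ cong suc)

  h-not-above : ∀ i → ¬ (toℕ i ≡ 1 × step i ≡ zero) → ¬ IsFixed h (V.to i) → ¬ (V.to i ≤ᶜ h (V.to i))
  h-not-above i not-top moves = subst (λ y → ¬ (V.to i ≤ᶜ y)) (sym (h-at i))
    (step-not-above i (λ eq → moves (trans (h-at i) (cong V.to eq))) not-top)

  coatom : ∃₂ λ c k → toℕ k ≡ 1 × V.to k ≡ flip ones c
  coatom with c , _ , eq ← descending-coatom n = c , second-lookup eq

  reaches : ∀ i → ∃ λ y → IsFixed h y × AlmostDecreasingPath h (V.to i) y
  reaches i with c , k , k≡1 , Vk ← coatom with step k Fin.≟ zero
  -- The exception concerns position 1 alone, which is `k`; without it, every configuration that is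
  -- not fixed has a decreasing arc.
  ... | no s≢0
    with y , fixed , path ← descend 0 (λ i _ → h-not-above i λ (i≡1 , s≡0) →
           s≢0 (subst (λ i → step i ≡ zero) (Fin.toℕ-injective (trans i≡1 (sym k≡1))) s≡0)) i z≤n
    = y , fixed , 0 , z≤n , path
  ... | yes s≡0 = by-position (toℕ i) refl
    where
    low : ∀ i → 2 ≤ toℕ i → ReachesFixed 0 (V.to i)
    low = descend 2 λ i 2≤i → h-not-above i λ (i≡1 , _) → contradiction (subst (2 ≤_) i≡1 2≤i) λ { (s≤s ()) }

    -- The position is positive by `from-flip`, and position 1 holds the coatom for `c`.
    avoids : ∀ d → d ≢ c → 2 ≤ toℕ (V.from (flip ones d))
    avoids d d≢c = ≤∧≢⇒< (from-flip zero d (lookup-replicate d true)) λ 1≡ →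
      d≢c (flip-injective ones d c (trans (sym (V.strictlyInverseˡ _))
        (trans (cong V.to (Fin.toℕ-injective (trans (sym 1≡) (sym k≡1)))) Vk)))

    from-ones : ReachesFixed 0 ones
    from-ones with coatom-trichotomy (h ones) c
    ... | inj₁ fixed          = ones , fixed , []
    -- Here `step` would exchange `zero` and `k`; `top-acyclic` then yields that `ones` is fixed.
    ... | inj₂ (inj₁ h≡coatom) = ones , trans (h-at zero) (cong V.to (top-acyclic zero refl ss≡0)) , []
      where
      V-step≡ : V.to (step zero) ≡ V.to k
      V-step≡ = trans (sym (h-at zero)) (trans h≡coatom (sym Vk))

      ss≡0 : step (step zero) ≡ zero
      ss≡0 = trans (cong step (unique⇒lookup-injective (descending-unique n) (step zero) k V-step≡)) s≡0
    ... | inj₂ (inj₂ (d , d≢c , hd))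
      with y , fixed , path ← low (V.from (flip ones d)) (avoids d d≢c)
      = y , fixed , descent-arc h (lookup-replicate d true) hd
          (subst (λ x → Path h x y 0) (V.strictlyInverseˡ _) path)

    by-position : ∀ p → toℕ i ≡ p → ∃ λ y → IsFixed h y × AlmostDecreasingPath h (V.to i) y
    by-position 0 i≡0 rewrite Fin.toℕ-injective {i = i} {j = zero} i≡0
      with y , fixed , path ← from-ones = y , fixed , 0 , z≤n , path
    -- The one increasing arc is spent on reaching `ones`.
    by-position 1 i≡1 rewrite Fin.toℕ-injective (trans i≡1 (sym k≡1))
      with y , fixed , path ← from-ones =
      y , fixed , 1 , s≤s z≤n , incArc (c , up , sym flipped) (below , distinct) path
      where
      flipped : flip (V.to k) c ≡ ones
      flipped = trans (cong (λ x → flip x c) Vk) (flip-involutive ones c)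

      below : V.to k ≤ᶜ ones
      below = subst (_≤ᶜ ones) (sym Vk) (flip-≤ ones c (lookup-replicate c true))

      distinct : V.to k ≢ ones
      distinct eq = flip-≢ ones c (trans (sym Vk) eq)

      hk≡ones : h (V.to k) ≡ ones
      hk≡ones = trans (h-at k) (cong V.to s≡0)

      up : Vec.lookup (h (V.to k)) c ≢ Vec.lookup (V.to k) c
      up rewrite hk≡ones | Vk | lookup∘updateAt c {not} ones | lookup-replicate c true = λ ()
    by-position (suc (suc p)) i≡p with y , fixed , path ← low i (subst (2 ≤_) (sym i≡p) (s≤s (s≤s z≤n))) =
      y , fixed , 0 , z≤n , path

theorem7 : (n : ℕ) (f : F n) → (∃ λ x → IsFixed f x) →
    Σ (F n) λ h → (h ∼ f) ×
    ((x : Config n) → ∃ λ y → IsFixed h y × AlmostDecreasingPath h x y)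
-- The cube of dimension 0 has an odd number of configurations, so the parity argument starts at
-- dimension 1.
theorem7 zero    f ([] , fixed) =
  f , ((λ x → x) , (λ x → x) , (λ _ → refl) , (λ _ → refl) , λ _ → refl) ,
  λ { [] → [] , fixed , 0 , z≤n , [] }
theorem7 (suc n) f fixed = h , h∼f , λ x →
  subst (λ x → ∃ λ y → IsFixed h y × AlmostDecreasingPath h x y) (V.strictlyInverseˡ x) (reaches (V.from x))
  where
  open Conjugate n (Arrange.arrangement _≟ᶜ_ f (descending-unique n) (descending-complete n)
    (descending-even n) fixed)
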